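{- Let $G=(V,E)$ be a graph. Then $G$ admits a pairing dominating set whose pairs are adjacent vertices if and only if $G$ has a $\{K^+_{2,\ell} : \ell\geq 0\}$-factor.
   Context: All graphs are finite and simple; $N[v]$ denotes the closed neighborhood of $v$. A pairing dominating set of a graph $G=(V,E)$ is a set of pairs of vertices $\{(u_1,v_1),\dots,(u_k,v_k)\}$ of $V$ such that all the vertices appearing in the pairs are distinct and $V=\bigcup_{i=1}^k \left(N[u_i]\cap N[v_i]\right)$. Its pairs are adjacent if $u_iv_i\in E$ for every $i$. For $\ell\ge 1$, $K^+_{2,\ell}$ is the complete bipartite graph $K_{2,\ell}$ with an additional edge between the two vertices of the part of size $2$; $K^+_{2,0}$ denotes $K_2$. For a family $\mathcal{F}$ of graphs, an $\mathcal{F}$-factor of $G$ is a spanning subgraph $H$ of $G$ (same vertex set) such that each connected component of $H$ is isomorphic to some graph in $\mathcal{F}$. -}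

module Defs where

open import Data.Empty using (⊥)
open import Data.Fin.Base using (Fin)
open import Data.Fin.Properties using (_≟_)
open import Data.List.Base using (List; []; _∷_; concatMap)
open import Data.List.Relation.Unary.All using (All)
open import Data.List.Relation.Unary.Any using (Any)
open import Data.List.Relation.Unary.Unique.Propositional using (Unique)
open import Data.Nat.Base using (ℕ)
open import Data.Product.Base using (_×_; _,_; ∃-syntax; uncurry)
open import Data.Refinement using (Refinement-syntax; value)
open import Data.Sum.Base using (_⊎_; inj₁; inj₂)
open import Data.Unit.Base using (⊤)
open import Function.Bundles using (_↔_; _⇔_; Inverse)
open import Level using (0ℓ)
open import Relation.Binary.Core using (Rel)
open import Relation.Binary.Construct.Closure.ReflexiveTransitive using (Star)
open import Relation.Binary.Definitions using (Symmetric; Decidable)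
open import Relation.Binary.PropositionalEquality.Core using (_≡_; _≢_; refl; ≢-sym)
open import Relation.Nullary.Decidable.Core using (yes; no; ¬?)
open import Relation.Nullary.Negation.Core using (¬_)
open import Relation.Unary using (Pred; _∈_; _∩_)

-- Adjacency is required to be decidable, which is automatic classically.
-- A finite graph is a graph on a finite type such as `Fin n`.
record Graph (V : Set) : Set₁ where
  field
    _~_      : Rel V 0ℓ
    _~?_     : Decidable _~_
    ~-sym    : Symmetric _~_
    ~-irrefl : ∀ {v} → ¬ (v ~ v)

module _ {V : Set} (G : Graph V) where
  open Graph G

  N[_] : V → Pred V 0ℓ
  N[ v ] w = w ≡ v ⊎ v ~ w

  record IsPairingDominatingSet (ps : List (V × V)) : Set where
    field
      distinct   : Unique (concatMap (λ (u , v) → u ∷ v ∷ []) ps)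
      dominating : ∀ x → Any (λ (u , v) → x ∈ N[ u ] ∩ N[ v ]) ps

  AdjacentPairs : List (V × V) → Set
  AdjacentPairs = All (uncurry _~_)

  Reachable : Rel V 0ℓ
  Reachable = Star _~_

  -- The connected component containing v.  The refinement type keeps the proof
  -- of reachability irrelevant, so that two vertices of the component are equal
  -- as soon as they are equal in V, however many walks lead to them.
  component : (v : V) → Graph [ w ∈ V ∣ Reachable v w ]
  component v = record
    { _~_      = λ x y → value x ~ value y
    ; _~?_     = λ x y → value x ~? value y
    ; ~-sym    = ~-sym
    ; ~-irrefl = ~-irrefl
    }

record _≅_ {V W : Set} (G : Graph V) (H : Graph W) : Set where
  private
    module G = Graph G
    module H = Graph H
  field
    bijection : V ↔ W
  open Inverse bijection using (to)
  field
    adjacency : ∀ x y → (x G.~ y) ⇔ (to x H.~ to y)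

_IsSpanningSubgraphOf_ : {V : Set} → Graph V → Graph V → Set
H IsSpanningSubgraphOf G = ∀ {x y} → x H.~ y → x G.~ y
  where
  module H = Graph H
  module G = Graph G

HasFactor : {I : Set} {W : I → Set} → (∀ i → Graph (W i)) →
            {V : Set} → Graph V → Set₁
HasFactor F {V} G = ∃[ H ] H IsSpanningSubgraphOf G ×
                    (∀ v → ∃[ i ] component H v ≅ F i)

HasAdjacentPairingDominatingSet : {V : Set} → Graph V → Set
HasAdjacentPairingDominatingSet G =
  ∃[ ps ] IsPairingDominatingSet G ps × AdjacentPairs G ps

-- Also for ℓ = 0, where the two vertices of `Fin 2` alone form K₂.
K⁺₂ : (ℓ : ℕ) → Graph (Fin 2 ⊎ Fin ℓ)
K⁺₂ ℓ = record
  { _~_      = Adj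
  ; _~?_     = adj?
  ; ~-sym    = λ {x} {y} → adj-sym x y
  ; ~-irrefl = λ {v} → adj-irrefl v
  }
  where
  Adj : Rel (Fin 2 ⊎ Fin ℓ) 0ℓ
  Adj (inj₁ i) (inj₁ j) = i ≢ j
  Adj (inj₁ _) (inj₂ _) = ⊤
  Adj (inj₂ _) (inj₁ _) = ⊤
  Adj (inj₂ _) (inj₂ _) = ⊥

  adj? : Decidable Adj
  adj? (inj₁ i) (inj₁ j) = ¬? (i ≟ j)
  adj? (inj₁ _) (inj₂ _) = yes _
  adj? (inj₂ _) (inj₁ _) = yes _
  adj? (inj₂ _) (inj₂ _) = no λ ()

  adj-sym : ∀ x y → Adj x y → Adj y x
  adj-sym (inj₁ _) (inj₁ _) i≢j = ≢-sym i≢j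
  adj-sym (inj₁ _) (inj₂ _) _   = _
  adj-sym (inj₂ _) (inj₁ _) _   = _

  adj-irrefl : ∀ v → ¬ Adj v v
  adj-irrefl (inj₁ _) i≢i = i≢i refl
  adj-irrefl (inj₂ _) ()

{-# OPTIONS --safe #-}
-- A pair (a , b) "spans a book" in H when a and b are adjacent and every vertex
-- reachable from a lies in N[a] ∩ N[b].  In a factor each vertex is dominated by
-- such a pair, and two such pairs sharing a vertex lie in the same component,
-- so greedily adding a pair whenever a vertex is not yet dominated keeps all
-- vertices distinct.
-- Conversely, sending each paired vertex to its own pair and every other vertex
-- to some pair dominating it partitions V; keeping, within each class, exactly
-- the edges that meet the pair yields the factor.
module Submission where

open import Defs
open import Data.Fin.Base using (Fin; suc)
open import Data.Fin.Patterns using (0F; 1F)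
open import Data.Fin.Properties using (_≟_)
open import Data.Irrelevant using ([_])
open import Data.List.Base using (List; []; _∷_; concatMap; length; lookup; filter; allFin)
open import Data.List.Membership.Propositional using (_∈_; _∉_; find; lose)
open import Data.List.Membership.Propositional.Properties
  using (∈-concatMap⁺; ∈-concatMap⁻; ∈-lookup; ∈-allFin; ∈-filter⁺; ∈-filter⁻)
open import Data.List.Relation.Unary.All as All using (All; []; _∷_)
open import Data.List.Relation.Unary.AllPairs using ([]; _∷_)
open import Data.List.Relation.Unary.Any as Any using (Any; here; there; any?; index)
open import Data.List.Relation.Unary.Any.Properties using (lookup-index)
open import Data.List.Relation.Unary.Unique.Propositional using (Unique)
open import Data.List.Relation.Unary.Unique.Propositional.Properties using (allFin⁺; filter⁺)
open import Data.Nat.Base using (ℕ)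
open import Data.Product.Base using (_×_; _,_; proj₁; proj₂; ∃-syntax)
open import Data.Product.Properties using (≡-dec)
open import Data.Refinement using (Refinement-syntax; value; value-injective; _,_)
open import Data.Sum.Base as Sum using (_⊎_; inj₁; inj₂)
open import Data.Unit.Base using (tt)
open import Function.Base using (_∘_)
open import Function.Bundles using (_⇔_; mk⇔; mk⤖; Inverse; Equivalence)
open import Function.Consequences.Propositional using (strictlySurjective⇒surjective)
open import Function.Definitions using (Injective; StrictlySurjective)
open import Function.Properties.Bijection using (⤖⇒↔)
open import Function.Properties.Inverse using (↔-sym)
open import Relation.Binary.Construct.Closure.ReflexiveTransitive using (ε; _◅_; _◅◅_; reverse)
open import Relation.Binary.Definitions using (DecidableEquality)
open import Relation.Binary.PropositionalEquality
  using (_≡_; _≢_; refl; sym; trans; cong; subst; subst₂; ≢-sym)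
open import Relation.Nullary using (Dec; yes; no; ¬_; contradiction)
open import Relation.Nullary.Decidable using (_×-dec_; _⊎-dec_; ¬?; recompute)

private
  variable
    A V W : Set

-- Lists without repetition and symmetry of isomorphism.

lookup-injective : {xs : List A} → Unique xs → Injective _≡_ _≡_ (lookup xs)
lookup-injective (_ ∷ _)    {0F}    {0F}    _  = refl
lookup-injective (x∉ ∷ _)   {0F}    {suc j} eq = contradiction eq (All.lookup x∉ (∈-lookup j))
lookup-injective (x∉ ∷ _)   {suc i} {0F}    eq = contradiction (sym eq) (All.lookup x∉ (∈-lookup i))
lookup-injective (_ ∷ uniq) {suc i} {suc j} eq = cong suc (lookup-injective uniq eq)

ends : A × A → List A
ends (a , b) = a ∷ b ∷ []

ends-fresh : {a b x : A} {xs : List A} → Unique (a ∷ b ∷ xs) → x ∈ ends (a , b) → x ∉ xs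
ends-fresh (a∉ ∷ _)     (here refl)         x∈ = All.lookup a∉ (there x∈) refl
ends-fresh (_ ∷ b∉ ∷ _) (there (here refl)) x∈ = All.lookup b∉ x∈ refl

-- A common end of the first pair and a later one would occur twice in the concatenation, so a
-- vertex determines its pair.
ends-injective : {ps : List (A × A)} → Unique (concatMap ends ps) → ∀ {p q x} →
                 p ∈ ps → q ∈ ps → x ∈ ends p → x ∈ ends q → p ≡ q
ends-injective _ (here refl) (here refl) _ _ = refl
ends-injective u (here refl) (there q∈) x∈p x∈q =
  contradiction (∈-concatMap⁺ ends (lose q∈ x∈q)) (ends-fresh u x∈p)
ends-injective u (there p∈) (here refl) x∈p x∈q =
  contradiction (∈-concatMap⁺ ends (lose p∈ x∈p)) (ends-fresh u x∈q)
ends-injective (_ ∷ _ ∷ uniq) (there p∈) (there q∈) x∈p x∈q =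
  ends-injective uniq p∈ q∈ x∈p x∈q

≅-sym : {G : Graph V} {H : Graph W} → G ≅ H → H ≅ G
≅-sym {G = G} {H = H} iso = record
  { bijection = ↔-sym bijection
  ; adjacency = λ x y → mk⇔
      (λ x~y → Equivalence.from (adjacency (from x) (from y))
                 (subst₂ H._~_ (sym (strictlyInverseˡ x)) (sym (strictlyInverseˡ y)) x~y))
      (λ x~y → subst₂ H._~_ (strictlyInverseˡ x) (strictlyInverseˡ y)
                 (Equivalence.to (adjacency (from x) (from y)) x~y))
  }
  where
  module H = Graph H
  open _≅_ iso
  open Inverse bijection using (from; strictlyInverseˡ)

-- From a factor to a pairing.

module _ (G : Graph V) where
  open Graph G

  Dominates : V × V → V → Set
  Dominates (a , b) x = N[_] G a x × N[_] G b x

  dominates? : DecidableEquality V → ∀ p x → Dec (Dominates p x)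
  dominates? _≟ⱽ_ (a , b) x = (x ≟ⱽ a ⊎-dec a ~? x) ×-dec (x ≟ⱽ b ⊎-dec b ~? x)

  ends-dominated : ∀ {a b x} → a ~ b → x ∈ ends (a , b) → Dominates (a , b) x
  ends-dominated a~b (here refl)         = inj₁ refl , inj₂ (~-sym a~b)
  ends-dominated a~b (there (here refl)) = inj₂ a~b , inj₁ refl

  N⇒reachable : ∀ {a x} → N[_] G a x → Reachable G a x
  N⇒reachable (inj₁ refl) = ε
  N⇒reachable (inj₂ a~x)  = a~x ◅ ε

  -- A triangular book is a set of triangles sharing the edge `a ~ b`. Edges among the remaining
  -- vertices are left unconstrained.
  SpansBook : V × V → Set
  SpansBook (a , b) = a ~ b × (∀ {x} → Reachable G a x → Dominates (a , b) x)

  -- The shared end `x` is equal or adjacent to `y`, and it is an end of `p`, so a walk leads from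
  -- the first end of `p` through `x` to `y`.
  spansBook⇒dominates : ∀ {p q x y} → SpansBook p → Dominates q y →
                        x ∈ ends p → x ∈ ends q → Dominates p y
  spansBook⇒dominates (_ , dom) (N₁ , N₂) (here refl) (here refl) =
    dom (N⇒reachable N₁)
  spansBook⇒dominates (_ , dom) (N₁ , N₂) (here refl) (there (here refl)) =
    dom (N⇒reachable N₂)
  spansBook⇒dominates (a~b , dom) (N₁ , N₂) (there (here refl)) (here refl) =
    dom (a~b ◅ N⇒reachable N₁)
  spansBook⇒dominates (a~b , dom) (N₁ , N₂) (there (here refl)) (there (here refl)) =
    dom (a~b ◅ N⇒reachable N₂)

  -- The shared edge of the book is the preimage of the two vertices of `Fin 2`, each of which is
  -- adjacent to every other vertex of `K⁺₂ ℓ`.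
  component≅K⁺₂⇒book : ∀ {v ℓ} → component G v ≅ K⁺₂ ℓ →
                       ∃[ p ] SpansBook p × Dominates p v
  component≅K⁺₂⇒book {v} {ℓ} iso =
    -- `dominates` concerns walks from `v`, whereas a book asks for walks from its first centre;
    -- hence the prefix `v↝a`.
    (centre 0F , centre 1F) , (centre~ (λ ()) , dominates ∘ (v↝a ◅◅_)) , v∈
    where
    open _≅_ iso
    open Inverse bijection using (from; strictlyInverseʳ)

    centre : Fin 2 → V
    centre i = value (from (inj₁ i))

    from~ : ∀ {i j} → Graph._~_ (K⁺₂ ℓ) i j → value (from i) ~ value (from j)
    from~ {i} {j} = Equivalence.to (_≅_.adjacency (≅-sym iso) i j)

    centre~ : ∀ {i j} → i ≢ j → centre i ~ centre j
    centre~ i≢j = from~ i≢j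

    centre-dominates : ∀ i k → N[_] G (centre i) (value (from k))
    centre-dominates i (inj₂ _) = inj₂ (from~ tt)
    centre-dominates i (inj₁ j) with i ≟ j
    ... | yes refl = inj₁ refl
    ... | no  i≢j  = inj₂ (centre~ i≢j)

    dominates : ∀ {x} → Reachable G v x → Dominates (centre 0F , centre 1F) x
    dominates {x} v↝x =
      subst (Dominates _) (cong value (strictlyInverseʳ (x , [ v↝x ])))
        (centre-dominates 0F _ , centre-dominates 1F _)

    v∈ : Dominates (centre 0F , centre 1F) v
    v∈ = dominates ε

    v↝a : Reachable G v (centre 0F)
    v↝a = reverse ~-sym (N⇒reachable (proj₁ v∈))

  -- Induction on the vertices still to be dominated. Carrying `All SpansBook ps` along is what
  -- keeps each new pair disjoint from the earlier ones.
  disjoint-books : DecidableEquality V → (∀ v → ∃[ p ] SpansBook p × Dominates p v) →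
                   ∀ xs → ∃[ ps ] Unique (concatMap ends ps) × All SpansBook ps ×
                                  (∀ {x} → x ∈ xs → Any (λ p → Dominates p x) ps)
  disjoint-books _≟ⱽ_ book [] = [] , [] , [] , λ ()
  disjoint-books _≟ⱽ_ book (x ∷ xs)
    with ps , uniq , books , dom ← disjoint-books _≟ⱽ_ book xs
    with any? (λ p → dominates? _≟ⱽ_ p x) ps
  ... | yes x∈ = ps , uniq , books , λ where
          (here refl) → x∈
          (there y∈)  → dom y∈
  ... | no x∉ with p@(a , b) , spans@(a~b , _) , p-dom ← book x =
    p ∷ ps , (a≢b ∷ fresh (here refl)) ∷ fresh (there (here refl)) ∷ uniq , spans ∷ books ,
    λ where
      (here refl) → here p-dom
      (there y∈)  → there (dom y∈)
    where
    a≢b : a ≢ b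
    a≢b refl = ~-irrefl a~b

    -- An earlier pair `q` sharing a vertex with `p` would dominate everything that `p` dominates,
    -- in particular `x`, against `x∉`.
    fresh : ∀ {y} → y ∈ ends p → All (y ≢_) (concatMap ends ps)
    fresh y∈p = All.tabulate λ { z∈ refl →
      let q , q∈ , y∈q = find (∈-concatMap⁻ ends {xs = ps} z∈) in
      x∉ (lose q∈ (spansBook⇒dominates {q} {p} (All.lookup books q∈) p-dom y∈q y∈p)) }

-- The books are chosen in `H`, whose components are known; passing to `G` only enlarges closed
-- neighborhoods.
factor⇒pairing : ∀ {n} (G : Graph (Fin n)) →
                 HasFactor K⁺₂ G → HasAdjacentPairingDominatingSet G
factor⇒pairing {n} G (H , H⊆G , comps) =
  let ps , uniq , books , dom =
        disjoint-books H _≟_ (λ v → component≅K⁺₂⇒book H (proj₂ (comps v))) (allFin n) in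
  ps ,
  record { distinct   = uniq
         ; dominating = λ x → Any.map (λ (N₁ , N₂) → Sum.map₂ H⊆G N₁ , Sum.map₂ H⊆G N₂)
                                      (dom (∈-allFin x)) } ,
  All.map (H⊆G ∘ proj₁) books

-- From a pairing to a partition of the vertices.

-- The partition is encoded by its fibres: two vertices share a class when they have the same
-- `pair`. By `pair-ends` each class contains its own two centres.
record Assignment (G : Graph V) : Set where
  open Graph G
  field
    pair      : V → V × V
    adjacent  : ∀ x → proj₁ (pair x) ~ proj₂ (pair x)
    dominates : ∀ x → Dominates G (pair x) x
    pair-ends : ∀ {x y} → y ∈ ends (pair x) → pair y ≡ pair x

module _ {n} (G : Graph (Fin n)) where
  open Graph G
  open import Data.List.Membership.DecPropositional (_≟_ {n}) using (_∈?_)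

  pairing⇒assignment : HasAdjacentPairingDominatingSet G → Assignment G
  pairing⇒assignment (ps , pds , adj) = record
    { pair      = proj₁ ∘ assign
    ; adjacent  = λ x → All.lookup adj (proj₁ (proj₂ (assign x)))
    ; dominates = λ x → proj₁ (proj₂ (proj₂ (assign x)))
    ; pair-ends = λ {x} {y} y∈ →
        proj₂ (proj₂ (proj₂ (assign y))) (proj₁ (proj₂ (assign x))) y∈
    }
    where
    open IsPairingDominatingSet pds

    -- The last component makes the choice forced on paired vertices, by distinctness; on the others
    -- it holds vacuously.
    assign : ∀ x → ∃[ p ] p ∈ ps × Dominates G p x × (∀ {q} → q ∈ ps → x ∈ ends q → p ≡ q)
    assign x with any? (λ p → x ∈? ends p) ps
    ... | yes x∈ = let p , p∈ , x∈p = find x∈ in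
          p , p∈ , ends-dominated G (All.lookup adj p∈) x∈p ,
          λ q∈ x∈q → ends-injective distinct p∈ q∈ x∈p x∈q
    ... | no  x∉ = let p , p∈ , dom = find (dominating x) in
          p , p∈ , dom , λ q∈ x∈q → contradiction (lose q∈ x∈q) x∉

  module _ (assignment : Assignment G) where
    open Assignment assignment

    Central : Fin n → Set
    Central x = x ∈ ends (pair x)

    central? : ∀ x → Dec (Central x)
    central? x = x ∈? ends (pair x)

    ends-central : ∀ {x y} → y ∈ ends (pair x) → Central y
    ends-central y∈ = subst (λ p → _ ∈ ends p) (sym (pair-ends y∈)) y∈

    -- The factor defined by the partition.

    -- Adjacency in `G` is not part of this definition: domination supplies it in `central~`. The
    -- centrality condition discards edges between two leaves.
    factor : Graph (Fin n)
    factor = record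
      { _~_      = λ x y → pair x ≡ pair y × x ≢ y × (Central x ⊎ Central y)
      ; _~?_     = λ x y → ≡-dec _≟_ _≟_ (pair x) (pair y) ×-dec ¬? (x ≟ y)
                             ×-dec (central? x ⊎-dec central? y)
      ; ~-sym    = λ (eq , x≢y , c) → sym eq , ≢-sym x≢y , Sum.swap c
      ; ~-irrefl = λ (_ , x≢x , _) → x≢x refl
      }
    module F = Graph factor

    -- `x` is an end of the pair that dominates `y`, and `x ≢ y` rules out the trivial case of the
    -- closed neighborhood.
    central~ : ∀ {x y} → Central x → pair x ≡ pair y → x ≢ y → x ~ y
    central~ {x} {y} x∈ eq x≢y with x∈ | subst (λ p → Dominates G p y) (sym eq) (dominates y)
    ... | here x≡         | inj₁ y≡ , _ = contradiction (trans x≡ (sym y≡)) x≢y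
    ... | here x≡         | inj₂ a~y , _ = subst (_~ y) (sym x≡) a~y
    ... | there (here x≡) | _ , inj₁ y≡ = contradiction (trans x≡ (sym y≡)) x≢y
    ... | there (here x≡) | _ , inj₂ b~y = subst (_~ y) (sym x≡) b~y

    factor⊆ : factor IsSpanningSubgraphOf G
    factor⊆ (eq , x≢y , inj₁ x∈) = central~ x∈ eq x≢y
    factor⊆ (eq , x≢y , inj₂ y∈) = ~-sym (central~ y∈ (sym eq) (≢-sym x≢y))

    reachable⇒pair≡ : ∀ {x y} → Reachable factor x y → pair y ≡ pair x
    reachable⇒pair≡ ε                = refl
    reachable⇒pair≡ ((eq , _) ◅ y↝z) = trans (reachable⇒pair≡ y↝z) (sym eq)

    reachable-centre : ∀ x → Reachable factor x (proj₁ (pair x))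
    reachable-centre x with x ≟ proj₁ (pair x)
    ... | yes eq = subst (Reachable factor x) eq ε
    ... | no  x≢ = (sym (pair-ends (here refl)) , x≢ , inj₂ (ends-central (here refl))) ◅ ε

    -- The first end of the common pair is a hub: the walk from `x` to it is followed by the
    -- reversed walk from `y`.
    pair≡⇒reachable : ∀ {x y} → pair y ≡ pair x → Reachable factor x y
    pair≡⇒reachable {x} {y} eq =
      subst (Reachable factor x ∘ proj₁) (sym eq) (reachable-centre x)
        ◅◅ reverse F.~-sym (reachable-centre y)

    -- Each component of the factor is a book.

    module _ (v : Fin n) where
      leaf? : ∀ x → Dec (pair x ≡ pair v × ¬ Central x)
      leaf? x = ≡-dec _≟_ _≟_ (pair x) (pair v) ×-dec ¬? (central? x)

      -- Its length is the `ℓ` of the component; filtering `allFin n` keeps the entries distinct.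
      leaves : List (Fin n)
      leaves = filter leaf? (allFin n)

      vertex : Fin 2 ⊎ Fin (length leaves) → Fin n
      vertex (inj₁ 0F) = proj₁ (pair v)
      vertex (inj₁ 1F) = proj₂ (pair v)
      vertex (inj₂ i)  = lookup leaves i

      centre∈ends : ∀ i → vertex (inj₁ i) ∈ ends (pair v)
      centre∈ends 0F = here refl
      centre∈ends 1F = there (here refl)

      lookup-leaf : ∀ i → pair (lookup leaves i) ≡ pair v × ¬ Central (lookup leaves i)
      lookup-leaf i = proj₂ (∈-filter⁻ leaf? {xs = allFin n} (∈-lookup i))

      pair-vertex : ∀ i → pair (vertex i) ≡ pair v
      pair-vertex (inj₁ i) = pair-ends (centre∈ends i)
      pair-vertex (inj₂ i) = proj₁ (lookup-leaf i)

      centres≢ : proj₁ (pair v) ≢ proj₂ (pair v)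
      centres≢ eq = ~-irrefl (subst (_~ proj₂ (pair v)) eq (adjacent v))

      -- The two centres differ because they are adjacent in `G`, and centrality separates centres
      -- from leaves.
      vertex-injective : Injective _≡_ _≡_ vertex
      vertex-injective {inj₁ 0F} {inj₁ 0F} _  = refl
      vertex-injective {inj₁ 0F} {inj₁ 1F} eq = contradiction eq centres≢
      vertex-injective {inj₁ 1F} {inj₁ 0F} eq = contradiction (sym eq) centres≢
      vertex-injective {inj₁ 1F} {inj₁ 1F} _  = refl
      vertex-injective {inj₁ i}  {inj₂ j}  eq =
        contradiction (subst Central eq (ends-central (centre∈ends i))) (proj₂ (lookup-leaf j))
      vertex-injective {inj₂ i}  {inj₁ j}  eq =
        contradiction (subst Central (sym eq) (ends-central (centre∈ends j))) (proj₂ (lookup-leaf i))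
      vertex-injective {inj₂ i}  {inj₂ j}  eq =
        cong inj₂ (lookup-injective (filter⁺ leaf? (allFin⁺ n)) eq)

      vertex-surjective : ∀ {x} → pair x ≡ pair v → ∃[ i ] vertex i ≡ x
      vertex-surjective {x} eq with central? x
      ... | no  x∉ = inj₂ (index x∈) , sym (lookup-index x∈)
        where
        x∈ : x ∈ leaves
        x∈ = ∈-filter⁺ leaf? (∈-allFin x) (eq , x∉)
      ... | yes (here x≡)         = inj₁ 0F , trans (cong proj₁ (sym eq)) (sym x≡)
      ... | yes (there (here x≡)) = inj₁ 1F , trans (cong proj₂ (sym eq)) (sym x≡)

      embed : Fin 2 ⊎ Fin (length leaves) → [ x ∈ Fin n ∣ Reachable factor v x ]
      embed i = vertex i , [ pair≡⇒reachable (pair-vertex i) ]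

      embed-injective : Injective _≡_ _≡_ embed
      embed-injective = vertex-injective ∘ cong value

      embed-surjective : StrictlySurjective _≡_ embed
      embed-surjective (x , [ v↝x ]) =
        -- The walk is irrelevant here, so the equation of pairs drawn from it is recovered by
        -- deciding it.
        let i , eq = vertex-surjective (recompute (≡-dec _≟_ _≟_ _ _) (reachable⇒pair≡ v↝x)) in
        i , value-injective eq

      vertex~ : ∀ i j → i ≢ j → Central (vertex i) ⊎ Central (vertex j) →
                vertex i F.~ vertex j
      vertex~ i j i≢j c =
        trans (pair-vertex i) (sym (pair-vertex j)) , i≢j ∘ vertex-injective , c

      -- All these vertices share the pair of `v`, so for distinct indices only centrality decides:
      -- it holds as soon as one index is a centre and fails for two leaves.
      embed-adjacency : ∀ i j → Graph._~_ (K⁺₂ (length leaves)) i j ⇔ vertex i F.~ vertex j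
      embed-adjacency (inj₁ i) (inj₁ j) = mk⇔
        (λ i≢j → vertex~ (inj₁ i) (inj₁ j) (λ { refl → i≢j refl }) (inj₁ (ends-central (centre∈ends i))))
        (λ { (_ , x≢y , _) refl → x≢y refl })
      embed-adjacency (inj₁ i) (inj₂ j) = mk⇔
        (λ _ → vertex~ (inj₁ i) (inj₂ j) (λ ()) (inj₁ (ends-central (centre∈ends i)))) _
      embed-adjacency (inj₂ i) (inj₁ j) = mk⇔
        (λ _ → vertex~ (inj₂ i) (inj₁ j) (λ ()) (inj₂ (ends-central (centre∈ends j)))) _
      embed-adjacency (inj₂ i) (inj₂ j) = mk⇔
        (λ ())
        (λ { (_ , _ , inj₁ c) → proj₂ (lookup-leaf i) c
           ; (_ , _ , inj₂ c) → proj₂ (lookup-leaf j) c })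

      -- The isomorphism is built out of `K⁺₂`, where `embed` is explicit, and then reversed.
      component≅K⁺₂ : component factor v ≅ K⁺₂ (length leaves)
      component≅K⁺₂ = ≅-sym record
        { bijection = ⤖⇒↔ (mk⤖ (embed-injective , strictlySurjective⇒surjective embed-surjective))
        ; adjacency = embed-adjacency
        }

  pairing⇒factor : HasAdjacentPairingDominatingSet G → HasFactor K⁺₂ G
  pairing⇒factor pairing =
    factor a , factor⊆ a , λ v → length (leaves a v) , component≅K⁺₂ a v
    where a = pairing⇒assignment pairing

proposition4p1 : (n : ℕ) (G : Graph (Fin n)) →
    HasAdjacentPairingDominatingSet G ⇔ HasFactor K⁺₂ G
proposition4p1 n G = mk⇔ (pairing⇒factor G) (factor⇒pairing G)
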